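{- For every formula $\varphi$, if $\vdash_{\mathbf{PTKv}^{ - }}\varphi$ then $\varphi$ is valid (true at every world of every model).
   Context: Fix a countable set $\mathsf{Prop}$ of propositional variables, a countable set $\mathsf{Term}$ of atomic terms, and a finite set of agents $\mathcal{A}=\{1,\dots,n\}$. Let $\Theta_K=[0,1]\cap\mathbb{Q}$ and $\Theta_V^+=(\frac12,1]\cap\mathbb{Q}$. Formulas are generated by $\varphi::= p\mid t=s\mid\neg\varphi\mid(\varphi\to\psi)\mid K_i^\theta\varphi\mid Kv_i^\eta(t)$ with $p\in\mathsf{Prop}$, $t,s\in\mathsf{Term}$, $i\in\mathcal{A}$, $\theta\in\Theta_K$, $\eta\in\Theta_V^+$; other connectives are standard abbreviations. A model is $M=(W,D,\{P_i\}_{i\in\mathcal{A}},V,\mathsf{val})$ with $W\neq\emptyset$, $D\neq\emptyset$, $P_i(w)$ a countably additive probability measure on the powerset of $W$ for each $i,w$, $V:W\times\mathsf{Prop}\to\{0,1\}$, $\mathsf{val}:W\times\mathsf{Term}\to D$. Write $\llbracket\varphi\rrbracket^M=\{u\mid M,u\models\varphi\}$ and $\llbracket t=d\rrbracket^M=\{u\mid \mathsf{val}(u,t)=d\}$. Satisfaction: $M,w\models p$ iff $V(w,p)=1$; $M,w\models t=s$ iff $\mathsf{val}(w,t)=\mathsf{val}(w,s)$; Boolean clauses as usual; $M,w\models K_i^\theta\varphi$ iff $P_i(w)(\llbracket\varphi\rrbracket^M)\ge\theta$; $M,w\models Kv_i^\eta(t)$ iff there exists a unique $d\in D$ with $P_i(w)(\llbracket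 t=d\rrbracket^M)\ge\eta$. The system $\mathbf{PTKv}^{ - }$ has rules Modus Ponens (from $\varphi$ and $\varphi\to\psi$ infer $\psi$) and $\mathrm{Nec}_K$ (from $\varphi$ infer $K_i^\theta\varphi$, for all $i\in\mathcal{A}$, $\theta\in\Theta_K$), and axiom schemata (for all agents $i$, terms $t,s,u$, formulas $\varphi,\psi$): all propositional tautologies; $t=t$; $t=s\to s=t$; $(t=s\wedge s=u)\to t=u$; $t=s\to((t=u)\leftrightarrow(s=u))$; $K_i^{\theta'}\varphi\to K_i^\theta\varphi$ for $\theta\le\theta'$ in $\Theta_K$; $K_i^\alpha(\varphi\to\psi)\to(K_i^\beta\varphi\to K_i^{\max\{0,\alpha+\beta-1\}}\psi)$ for $\alpha,\beta\in\Theta_K$; $K_i^\alpha\varphi\to\neg K_i^\beta\neg\varphi$ for $\alpha,\beta\in\Theta_K$ with $\alpha+\beta>1$; $K_i^0\varphi$; $K_i^1(t=s)\to(K_i^\theta(t=u)\leftrightarrow K_i^\theta(s=u))$ for $\theta\in\Theta_K$; $K_i^1(t=s)\to(Kv_i^\eta(t)\leftrightarrow Kv_i^\eta(s))$ for $\eta\in\Theta_V^+$. -}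

module Defs where

open import Algebra.Bundles using (CommutativeMonoid)
import Algebra.Properties.CommutativeSemigroup as CommutativeSemigroupProperties
open import Data.Bool.Base using (Bool; true; not; _∨_)
open import Data.Fin.Base using (Fin)
open import Data.Nat.Base as ℕ using (ℕ; zero; suc)
import Data.Nat.Properties as ℕₚ
open import Data.Product.Base using (∃-syntax; _×_; _,_)
open import Data.Product using (∃!)
open import Data.Rational.Base
  using (ℚ; 0ℚ; 1ℚ; ½; _+_; _-_; _*_; -_; _⊔_; _≤_; _<_; ∣_∣; positive)
import Data.Rational.Properties as ℚ
open import Function.Bundles using (_↣_)
open import Level using (Level; Lift) renaming (suc to lsuc)
open import Relation.Binary.PropositionalEquality
  using (_≡_; _≢_; refl; sym; trans; cong; subst)
open import Relation.Nullary using (¬_)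
open import Relation.Unary using (Pred; _≐_; _⊥_; ⋃)
open import Relation.Unary.Polymorphic using (U; ∅)

------------------------------------------------------------------------
-- Real numbers: Cantor's construction, by Cauchy sequences of rationals.
-- Equality of reals is the setoid equality _≈ᴿ_, not _≡_.

IsCauchy : (ℕ → ℚ) → Set
IsCauchy s = ∀ ε → 0ℚ < ε →
  ∃[ N ] (∀ m n → N ℕ.≤ m → N ℕ.≤ n → ∣ s m - s n ∣ < ε)

record ℝ : Set where
  constructor mkℝ
  field
    seq    : ℕ → ℚ
    cauchy : IsCauchy seq

open ℝ public

infixl 6 _+ᴿ_
infix  4 _≤ᴿ_ _≈ᴿ_

_≤ᴿ_ : ℝ → ℝ → Set
x ≤ᴿ y = ∀ ε → 0ℚ < ε → ∃[ N ] (∀ n → N ℕ.≤ n → seq x n ≤ seq y n + ε)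

_≈ᴿ_ : ℝ → ℝ → Set
x ≈ᴿ y = x ≤ᴿ y × y ≤ᴿ x

fromℚ : ℚ → ℝ
fromℚ q = mkℝ (λ _ → q) λ ε 0<ε →
  0 , λ _ _ _ _ → subst (λ d → ∣ d ∣ < ε) (sym (ℚ.+-inverseʳ q)) 0<ε

private
  0<ε/2 : ∀ ε → 0ℚ < ε → 0ℚ < ½ * ε
  0<ε/2 ε 0<ε = subst (_< ½ * ε) (ℚ.*-zeroʳ ½) (ℚ.*-monoʳ-<-pos ½ 0<ε)

  interchange : ∀ a b c d → (a + b) - (c + d) ≡ (a - c) + (b - d)
  interchange a b c d =
    trans (cong (a + b +_) (ℚ.neg-distrib-+ c d)) (medial a b (- c) (- d))
    where
    open CommutativeSemigroupProperties
      (CommutativeMonoid.commutativeSemigroup ℚ.+-0-commutativeMonoid)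
      using () renaming (interchange to medial)

  halves : ∀ ε → ½ * ε + ½ * ε ≡ ε
  halves ε = trans (sym (ℚ.*-distribʳ-+ ε ½ ½)) (ℚ.*-identityˡ ε)

  +-cauchy : ∀ x y → IsCauchy (λ n → seq x n + seq y n)
  +-cauchy x y ε 0<ε
    with cauchy x (½ * ε) (0<ε/2 ε 0<ε) | cauchy y (½ * ε) (0<ε/2 ε 0<ε)
  ... | M , f | N , g = M ℕ.⊔ N , λ m n p q →
    subst (λ d → ∣ d ∣ < ε) (sym (interchange (seq x m) (seq y m) (seq x n) (seq y n)))
      (ℚ.≤-<-trans
        (ℚ.∣p+q∣≤∣p∣+∣q∣ (seq x m - seq x n) (seq y m - seq y n))
        (subst (∣ seq x m - seq x n ∣ + ∣ seq y m - seq y n ∣ <_) (halves ε)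
          (ℚ.+-mono-<
            (f m n (ℕₚ.m⊔n≤o⇒m≤o M N p) (ℕₚ.m⊔n≤o⇒m≤o M N q))
            (g m n (ℕₚ.m⊔n≤o⇒n≤o M N p) (ℕₚ.m⊔n≤o⇒n≤o M N q)))))

_+ᴿ_ : ℝ → ℝ → ℝ
x +ᴿ y = mkℝ (λ n → seq x n + seq y n) (+-cauchy x y)

0ᴿ 1ᴿ : ℝ
0ᴿ = fromℚ 0ℚ
1ᴿ = fromℚ 1ℚ

infix 4 _⟶_

-- Rational ε suffice for limits, as they are cofinal below the positive reals.
_⟶_ : (ℕ → ℝ) → ℝ → Set
s ⟶ x = ∀ ε → 0ℚ < ε → ∃[ N ] (∀ n → N ℕ.≤ n →
  s n ≤ᴿ x +ᴿ fromℚ ε × x ≤ᴿ s n +ᴿ fromℚ ε)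

partialSum : (ℕ → ℝ) → ℕ → ℝ
partialSum a zero    = 0ᴿ
partialSum a (suc n) = partialSum a n +ᴿ a n

HasSum : (ℕ → ℝ) → ℝ → Set
HasSum a x = partialSum a ⟶ x

------------------------------------------------------------------------
-- Probability measures on the full powerset of W

-- Subsets are predicates up to extensional equality _≐_, so μ must respect it.
record ProbabilityMeasure {ℓ} (W : Set ℓ) : Set (lsuc ℓ) where
  field
    μ          : Pred W ℓ → ℝ
    μ-cong     : ∀ {A B} → A ≐ B → μ A ≈ᴿ μ B
    μ-nonneg   : ∀ A → 0ᴿ ≤ᴿ μ A
    μ-empty    : μ ∅ ≈ᴿ 0ᴿ
    μ-total    : μ U ≈ᴿ 1ᴿ
    μ-additive : (A : ℕ → Pred W ℓ) → (∀ i j → i ≢ j → A i ⊥ A j) →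
                 HasSum (λ n → μ (A n)) (μ (⋃ ℕ A))

open ProbabilityMeasure public

------------------------------------------------------------------------
-- Syntax

record Θᴷ : Set where
  constructor mkΘᴷ
  field
    value : ℚ
    0≤    : 0ℚ ≤ value
    ≤1    : value ≤ 1ℚ

record Θⱽ⁺ : Set where
  constructor mkΘⱽ⁺
  field
    value : ℚ
    ½<    : ½ < value
    ≤1    : value ≤ 1ℚ

⌊_⌋ᴷ : Θᴷ → ℚ
⌊_⌋ᴷ = Θᴷ.value

⌊_⌋ⱽ : Θⱽ⁺ → ℚ
⌊_⌋ⱽ = Θⱽ⁺.value

0ᴷ 1ᴷ : Θᴷ
0ᴷ = mkΘᴷ 0ℚ ℚ.≤-refl (ℚ.nonNegative⁻¹ 1ℚ)
1ᴷ = mkΘᴷ 1ℚ (ℚ.nonNegative⁻¹ 1ℚ) ℚ.≤-refl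

-- max {0, α + β - 1}
_⊙_ : Θᴷ → Θᴷ → Θᴷ
mkΘᴷ α _ α≤1 ⊙ mkΘᴷ β _ β≤1 = mkΘᴷ (0ℚ ⊔ (α + β - 1ℚ))
  (ℚ.p≤p⊔q 0ℚ (α + β - 1ℚ))
  (ℚ.⊔-lub (ℚ.nonNegative⁻¹ 1ℚ)
           (ℚ.+-mono-≤ (ℚ.+-mono-≤ α≤1 β≤1) (ℚ.≤-refl { - 1ℚ })))

-- Countable means finite or countably infinite.
record Signature : Set₁ where
  field
    PropVar           : Set
    Term              : Set
    PropVar-countable : PropVar ↣ ℕ
    Term-countable    : Term ↣ ℕ
    agents            : ℕ

  Agent : Set
  Agent = Fin agents

open Signature public

infix  9 ~_
infix  8 _==_
infixr 7 _∧_
infixr 6 _⇒_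
infix  5 _⇔_

data Formula (S : Signature) : Set where
  var  : PropVar S → Formula S
  _==_ : Term S → Term S → Formula S
  ~_   : Formula S → Formula S
  _⇒_  : Formula S → Formula S → Formula S
  K    : Agent S → Θᴷ → Formula S → Formula S
  Kv   : Agent S → Θⱽ⁺ → Term S → Formula S

_∧_ : ∀ {S} → Formula S → Formula S → Formula S
φ ∧ ψ = ~ (φ ⇒ ~ ψ)

_⇔_ : ∀ {S} → Formula S → Formula S → Formula S
φ ⇔ ψ = (φ ⇒ ψ) ∧ (ψ ⇒ φ)

-- The truth-table value of φ, where every subformula whose main symbol is
-- neither ~ nor ⇒ is treated as a propositional letter with value given by v.
eval : ∀ {S} → (Formula S → Bool) → Formula S → Bool
eval v (~ φ)   = not (eval v φ)
eval v (φ ⇒ ψ) = not (eval v φ) ∨ eval v ψ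
eval v χ       = v χ

Tautology : ∀ {S} → Formula S → Set
Tautology φ = ∀ v → eval v φ ≡ true

------------------------------------------------------------------------
-- The system PTKv⁻

infix 3 ⊢_

data ⊢_ {S : Signature} : Formula S → Set where
  mp       : ∀ {φ ψ} → ⊢ φ → ⊢ φ ⇒ ψ → ⊢ ψ
  nec      : ∀ {φ} i θ → ⊢ φ → ⊢ K i θ φ

  taut     : ∀ {φ} → Tautology φ → ⊢ φ
  ==-refl  : ∀ t → ⊢ t == t
  ==-sym   : ∀ t s → ⊢ t == s ⇒ s == t
  ==-trans : ∀ t s u → ⊢ (t == s ∧ s == u) ⇒ t == u
  ==-subst : ∀ t s u → ⊢ t == s ⇒ (t == u ⇔ s == u)
  K-mono   : ∀ i θ θ′ φ → ⌊ θ ⌋ᴷ ≤ ⌊ θ′ ⌋ᴷ → ⊢ K i θ′ φ ⇒ K i θ φ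
  K-dist   : ∀ i α β φ ψ → ⊢ K i α (φ ⇒ ψ) ⇒ (K i β φ ⇒ K i (α ⊙ β) ψ)
  K-cons   : ∀ i α β φ → 1ℚ < ⌊ α ⌋ᴷ + ⌊ β ⌋ᴷ → ⊢ K i α φ ⇒ ~ K i β (~ φ)
  K-zero   : ∀ i φ → ⊢ K i 0ᴷ φ
  K-==     : ∀ i θ t s u →
             ⊢ K i 1ᴷ (t == s) ⇒ (K i θ (t == u) ⇔ K i θ (s == u))
  Kv-==    : ∀ i η t s → ⊢ K i 1ᴷ (t == s) ⇒ (Kv i η t ⇔ Kv i η s)

------------------------------------------------------------------------
-- Semantics

record Model (ℓ : Level) (S : Signature) : Set (lsuc ℓ) where
  field
    W          : Set ℓ
    D          : Set ℓ
    W-nonempty : W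
    D-nonempty : D
    P          : Agent S → W → ProbabilityMeasure W
    V          : W → PropVar S → Bool
    val        : W → Term S → D

module _ {ℓ} {S : Signature} (M : Model ℓ S) where
  open Model M

  ⟦_≔_⟧ : Term S → D → Pred W ℓ
  ⟦ t ≔ d ⟧ = λ u → val u t ≡ d

  -- ⟦ φ ⟧ w is the satisfaction relation M , w ⊨ φ.  The Lifts only move
  -- small propositions into the universe of W, where the powerset lives.
  ⟦_⟧ : Formula S → Pred W ℓ
  ⟦ var p ⟧    w = Lift ℓ (V w p ≡ true)
  ⟦ t == s ⟧   w = val w t ≡ val w s
  ⟦ ~ φ ⟧      w = ¬ ⟦ φ ⟧ w
  ⟦ φ ⇒ ψ ⟧    w = ⟦ φ ⟧ w → ⟦ ψ ⟧ w
  ⟦ K i θ φ ⟧  w = Lift ℓ (fromℚ ⌊ θ ⌋ᴷ ≤ᴿ μ (P i w) ⟦ φ ⟧)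
  ⟦ Kv i η t ⟧ w = ∃! _≡_ λ d → fromℚ ⌊ η ⌋ⱽ ≤ᴿ μ (P i w) ⟦ t ≔ d ⟧

infix 3 _,_⊨_

_,_⊨_ : ∀ {ℓ S} (M : Model ℓ S) → Model.W M → Formula S → Set ℓ
M , w ⊨ φ = ⟦_⟧ M φ w

Valid : ∀ ℓ {S} → Formula S → Set (lsuc ℓ)
Valid ℓ {S} φ = (M : Model ℓ S) (w : Model.W M) → M , w ⊨ φ

{-# OPTIONS --safe #-}

-- Everything probabilistic in the axioms reduces to one inequality: if
-- A ∩ C ⊆ B then μ A + μ C ≤ μ B + 1, because μ A ≤ μ B + μ (A ∖ B) and
-- C is disjoint from A ∖ B.

module Submission where

open import Defs
open import Axiom.ExcludedMiddle using (ExcludedMiddle)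
open import Data.Bool.Base using (Bool)
open import Data.Nat.Base as ℕ using (ℕ; zero; suc)
import Data.Nat.Properties as ℕ
open import Data.Product.Base using (_,_; proj₁; proj₂; map₂)
open import Data.Rational.Base
  using (0ℚ; 1ℚ; ½; _+_; _-_; _*_; -_; _≤_; _<_)
import Data.Rational.Properties as ℚ
open import Data.Rational.Solver using (module +-*-Solver)
open import Data.Sum.Base using (inj₁; inj₂; [_,_]′)
open import Function.Base using (_∘_)
open import Level using (Level; lift; 0ℓ)
open import Relation.Binary.Bundles using (Poset)
open import Relation.Binary.PropositionalEquality
  using (_≡_; _≢_; refl; sym; trans; subst)
import Relation.Binary.Reasoning.PartialOrder as PartialOrderReasoning
open import Relation.Nullary using (¬_; yes; no; does; proof; contradiction)
open import Relation.Nullary.Decidable using (decidable-stable)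
open import Relation.Nullary.Reflects
  using (Reflects; invert; ¬-reflects; _→-reflects_)
open import Relation.Unary using (Pred; _⊆_; _≐_; _⊥_; _∪_; _∩_; ∁; ⋃)
open import Relation.Unary.Polymorphic using (U; ∅)

-- Real numbers

-- Soundness is by induction on derivations, for all worlds at once, since necessitation needs its
-- premise everywhere. Excluded middle makes satisfaction two-valued, so at each world it agrees
-- with a truth-table valuation and every tautology holds. The axioms for `==` at a single world are
-- properties of equality in the domain.
--
-- For the axioms that combine measures, take A ∩ C ⊆ B in μ A + μ C ≤ μ B + 1 (`μ-modus-ponens`).
-- With the extensions of φ ⇒ ψ, φ and ψ as A, C and B it gives distribution; with B empty it bounds
-- the thresholds of disjoint events by 1, which is consistency; with μ C ≥ 1 it carries lower
-- bounds from A to B (`μ-certain`), which lets almost surely equal terms replace each other under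
-- `K` and `Kv`.
--
-- The inequality rests on monotonicity and additivity for two disjoint sets, the latter extracted
-- from countable additivity by padding with empty sets.

0<½* : ∀ {ε} → 0ℚ < ε → 0ℚ < ½ * ε
0<½* {ε} 0<ε = subst (_< ½ * ε) (ℚ.*-zeroʳ ½) (ℚ.*-monoʳ-<-pos ½ 0<ε)

≤-trans-½ : ∀ ε p q r → p ≤ q + ½ * ε → q ≤ r + ½ * ε → p ≤ r + ε
≤-trans-½ ε p q r p≤q q≤r = begin
  p                     ≤⟨ p≤q ⟩
  q + ½ * ε             ≤⟨ ℚ.+-monoˡ-≤ (½ * ε) q≤r ⟩
  r + ½ * ε + ½ * ε     ≡⟨ solve 2 (λ r e → r :+ con ½ :* e :+ con ½ :* e := r :+ e) refl r ε ⟩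
  r + ε                 ∎
  where
  open ℚ.≤-Reasoning
  open +-*-Solver

≤⇒≤+ : ∀ {ε p q} → 0ℚ < ε → p ≤ q → p ≤ q + ε
≤⇒≤+ {ε} {p} {q} 0<ε p≤q =
  subst (_≤ q + ε) (ℚ.+-identityʳ p) (ℚ.+-mono-≤ p≤q (ℚ.<⇒≤ 0<ε))

pointwise⇒≤ᴿ : ∀ x y → (∀ n → seq x n ≤ seq y n) → x ≤ᴿ y
pointwise⇒≤ᴿ x y x≤y ε 0<ε = 0 , λ n _ → ≤⇒≤+ 0<ε (x≤y n)

pointwise⇒≈ᴿ : ∀ x y → (∀ n → seq x n ≡ seq y n) → x ≈ᴿ y
pointwise⇒≈ᴿ x y x≡y =
  pointwise⇒≤ᴿ x y (ℚ.≤-reflexive ∘ x≡y) ,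
  pointwise⇒≤ᴿ y x (ℚ.≤-reflexive ∘ sym ∘ x≡y)

≤ᴿ-trans : ∀ x y z → x ≤ᴿ y → y ≤ᴿ z → x ≤ᴿ z
≤ᴿ-trans x y z x≤y y≤z ε 0<ε
  with x≤y (½ * ε) (0<½* 0<ε) | y≤z (½ * ε) (0<½* 0<ε)
... | M , f | N , g = M ℕ.⊔ N , λ n M⊔N≤n →
  ≤-trans-½ ε (seq x n) (seq y n) (seq z n)
    (f n (ℕ.m⊔n≤o⇒m≤o M N M⊔N≤n)) (g n (ℕ.m⊔n≤o⇒n≤o M N M⊔N≤n))

≤ᴿ-poset : Poset 0ℓ 0ℓ 0ℓ
≤ᴿ-poset = record
  { Carrier        = ℝ
  ; _≈_            = _≈ᴿ_
  ; _≤_            = _≤ᴿ_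
  ; isPartialOrder = record
    { isPreorder = record
      { isEquivalence = record
        { refl  = λ {x} → pointwise⇒≈ᴿ x x λ _ → refl
        ; sym   = λ (x≤y , y≤x) → y≤x , x≤y
        ; trans = λ {x} {y} {z} (x≤y , y≤x) (y≤z , z≤y) →
            ≤ᴿ-trans x y z x≤y y≤z , ≤ᴿ-trans z y x z≤y y≤x
        }
      ; reflexive = proj₁
      ; trans     = λ {x} {y} {z} → ≤ᴿ-trans x y z
      }
    ; antisym = _,_
    }
  }

module ≤ᴿ-Reasoning = PartialOrderReasoning ≤ᴿ-poset

-- The slack ε is spent in two halves: one on the hypothesis, the other on the tolerance built into
-- `≤ᴿ`.
≤ᴿ-archimedean : ∀ x y → (∀ ε → 0ℚ < ε → x ≤ᴿ y +ᴿ fromℚ ε) → x ≤ᴿ y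
≤ᴿ-archimedean x y x≤y+ ε 0<ε =
  map₂ (λ f n N≤n → ≤-trans-½ ε (seq x n) (seq y n + ½ * ε) (seq y n) (f n N≤n) ℚ.≤-refl)
    (x≤y+ (½ * ε) (0<½* 0<ε) (½ * ε) (0<½* 0<ε))

+ᴿ-comm : ∀ x y → x +ᴿ y ≈ᴿ y +ᴿ x
+ᴿ-comm x y = pointwise⇒≈ᴿ (x +ᴿ y) (y +ᴿ x) λ n → ℚ.+-comm (seq x n) (seq y n)

+ᴿ-assoc : ∀ x y z → x +ᴿ y +ᴿ z ≈ᴿ x +ᴿ (y +ᴿ z)
+ᴿ-assoc x y z = pointwise⇒≈ᴿ (x +ᴿ y +ᴿ z) (x +ᴿ (y +ᴿ z)) λ n →
  ℚ.+-assoc (seq x n) (seq y n) (seq z n)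

+ᴿ-identityˡ : ∀ x → 0ᴿ +ᴿ x ≈ᴿ x
+ᴿ-identityˡ x = pointwise⇒≈ᴿ (0ᴿ +ᴿ x) x λ n → ℚ.+-identityˡ (seq x n)

+ᴿ-identityʳ : ∀ x → x +ᴿ 0ᴿ ≈ᴿ x
+ᴿ-identityʳ x = pointwise⇒≈ᴿ (x +ᴿ 0ᴿ) x λ n → ℚ.+-identityʳ (seq x n)

+ᴿ-monoˡ-≤ᴿ : ∀ z x y → x ≤ᴿ y → x +ᴿ z ≤ᴿ y +ᴿ z
+ᴿ-monoˡ-≤ᴿ z x y x≤y ε 0<ε = map₂ (λ f n N≤n →
  ℚ.≤-trans (ℚ.+-monoˡ-≤ (seq z n) (f n N≤n)) (ℚ.≤-reflexive
    (solve 3 (λ y z e → y :+ e :+ z := y :+ z :+ e) refl (seq y n) (seq z n) ε)))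
  (x≤y ε 0<ε)
  where open +-*-Solver

+ᴿ-mono-≤ᴿ : ∀ x y u v → x ≤ᴿ y → u ≤ᴿ v → x +ᴿ u ≤ᴿ y +ᴿ v
+ᴿ-mono-≤ᴿ x y u v x≤y u≤v = begin
  x +ᴿ u ≤⟨ +ᴿ-monoˡ-≤ᴿ u x y x≤y ⟩
  y +ᴿ u ≈⟨ +ᴿ-comm y u ⟩
  u +ᴿ y ≤⟨ +ᴿ-monoˡ-≤ᴿ y u v u≤v ⟩
  v +ᴿ y ≈⟨ +ᴿ-comm v y ⟩
  y +ᴿ v ∎
  where open ≤ᴿ-Reasoning

+ᴿ-monoʳ-≤ᴿ : ∀ z x y → x ≤ᴿ y → z +ᴿ x ≤ᴿ z +ᴿ y
+ᴿ-monoʳ-≤ᴿ z x y = +ᴿ-mono-≤ᴿ z z x y (pointwise⇒≤ᴿ z z λ _ → ℚ.≤-refl)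

+ᴿ-cong : ∀ x y u v → x ≈ᴿ y → u ≈ᴿ v → x +ᴿ u ≈ᴿ y +ᴿ v
+ᴿ-cong x y u v (x≤y , y≤x) (u≤v , v≤u) =
  +ᴿ-mono-≤ᴿ x y u v x≤y u≤v , +ᴿ-mono-≤ᴿ y x v u y≤x v≤u

+ᴿ-cancelʳ-≤ᴿ : ∀ z x y → x +ᴿ z ≤ᴿ y +ᴿ z → x ≤ᴿ y
+ᴿ-cancelʳ-≤ᴿ z x y x+z≤y+z ε 0<ε = map₂ (λ f n N≤n → cancel n (f n N≤n))
  (x+z≤y+z ε 0<ε)
  where
  open ℚ.≤-Reasoning
  open +-*-Solver
  cancel : ∀ n → seq x n + seq z n ≤ seq y n + seq z n + ε → seq x n ≤ seq y n + ε
  cancel n h = begin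
    seq x n                              ≡⟨ solve 2 (λ x z → x := x :+ z :- z) refl (seq x n) (seq z n) ⟩
    seq x n + seq z n - seq z n          ≤⟨ ℚ.+-monoˡ-≤ (- seq z n) h ⟩
    seq y n + seq z n + ε - seq z n      ≡⟨ solve 3 (λ y z e → y :+ z :+ e :- z := y :+ e) refl (seq y n) (seq z n) ε ⟩
    seq y n + ε                          ∎

fromℚ-mono-≤ᴿ : ∀ {p q} → p ≤ q → fromℚ p ≤ᴿ fromℚ q
fromℚ-mono-≤ᴿ {p} {q} p≤q = pointwise⇒≤ᴿ (fromℚ p) (fromℚ q) λ _ → p≤q

fromℚ-cancel-≤ᴿ : ∀ {p q} → fromℚ p ≤ᴿ fromℚ q → p ≤ q
fromℚ-cancel-≤ᴿ {p} {q} p≤q = ℚ.≮⇒≥ λ q<p →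
  -- The slack p - q would only give p ≤ p; a rational r strictly between q and p gives p ≤ r < p.
  let r , q<r , r<p = ℚ.<-dense q<p
      0<r-q = subst (_< r - q) (ℚ.+-inverseʳ q) (ℚ.+-monoˡ-< (- q) q<r)
      N , f = p≤q (r - q) 0<r-q
      q+[r-q]≡r = solve 2 (λ q r → q :+ (r :- q) := r) refl q r
  in ℚ.<-irrefl refl (ℚ.≤-<-trans (subst (p ≤_) q+[r-q]≡r (f N ℕ.≤-refl)) r<p)
  where open +-*-Solver

-- The index N + m is late enough both for the ε-bound and for the constant range, which leaves x
-- and y within every ε of each other.
eventually-constant⇒limit : ∀ s x y → s ⟶ x → ∀ m → (∀ n → s (n ℕ.+ m) ≈ᴿ y) → x ≈ᴿ y
eventually-constant⇒limit s x y s⟶x m s≈y =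
  ≤ᴿ-archimedean x y (λ ε 0<ε → let N , f = s⟶x ε 0<ε in begin
    x                          ≤⟨ proj₂ (f (N ℕ.+ m) (ℕ.m≤m+n N m)) ⟩
    s (N ℕ.+ m) +ᴿ fromℚ ε     ≤⟨ +ᴿ-monoˡ-≤ᴿ (fromℚ ε) (s (N ℕ.+ m)) y (proj₁ (s≈y N)) ⟩
    y +ᴿ fromℚ ε               ∎) ,
  ≤ᴿ-archimedean y x (λ ε 0<ε → let N , f = s⟶x ε 0<ε in begin
    y                          ≈⟨ s≈y N ⟨
    s (N ℕ.+ m)                ≤⟨ proj₁ (f (N ℕ.+ m) (ℕ.m≤m+n N m)) ⟩
    x +ᴿ fromℚ ε               ∎)
  where open ≤ᴿ-Reasoning

-- Probability measures

module _ {ℓ} {W : Set ℓ} where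

  -- Presents a two-set union as a countable one, the form that `μ-additive` accepts.
  pad : Pred W ℓ → Pred W ℓ → ℕ → Pred W ℓ
  pad A B 0             = A
  pad A B 1             = B
  pad A B (suc (suc _)) = ∅

  pad-disjoint : ∀ {A B} → A ⊥ B → ∀ i j → i ≢ j → pad A B i ⊥ pad A B j
  pad-disjoint A⊥B 0             0             i≢j _       = contradiction refl i≢j
  pad-disjoint A⊥B 0             1             i≢j (a , b) = A⊥B (a , b)
  pad-disjoint A⊥B 0             (suc (suc _)) i≢j (_ , ())
  pad-disjoint A⊥B 1             0             i≢j (b , a) = A⊥B (a , b)
  pad-disjoint A⊥B 1             1             i≢j _       = contradiction refl i≢j
  pad-disjoint A⊥B 1             (suc (suc _)) i≢j (_ , ())
  pad-disjoint A⊥B (suc (suc _)) j             i≢j (() , _)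

  ⋃-pad : ∀ A B → ⋃ ℕ (pad A B) ≐ A ∪ B
  ⋃-pad A B = to , [ 0 ,_ , 1 ,_ ]′
    where
    to : ⋃ ℕ (pad A B) ⊆ A ∪ B
    to (0 , a) = inj₁ a
    to (1 , b) = inj₂ b

  module _ (ℙ : ProbabilityMeasure W) where

    open ≤ᴿ-Reasoning

    partialSum-pad : ∀ A B n →
      partialSum (λ k → μ ℙ (pad A B k)) (n ℕ.+ 2) ≈ᴿ μ ℙ A +ᴿ μ ℙ B
    partialSum-pad A B zero =
      +ᴿ-cong (0ᴿ +ᴿ μ ℙ A) (μ ℙ A) (μ ℙ B) (μ ℙ B)
        (+ᴿ-identityˡ (μ ℙ A)) (pointwise⇒≈ᴿ (μ ℙ B) (μ ℙ B) λ _ → refl)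
    -- `pad A B` reduces to `∅` only at an index of the form `suc (suc _)`, so n + 2 is turned into
    -- 2 + n; `hyp` transports the induction hypothesis to match.
    partialSum-pad A B (suc n) rewrite ℕ.+-comm n 2 = begin-equality
      Σₙ +ᴿ μ ℙ ∅                ≈⟨ +ᴿ-cong Σₙ (μ ℙ A +ᴿ μ ℙ B) (μ ℙ ∅) 0ᴿ hyp (μ-empty ℙ) ⟩
      μ ℙ A +ᴿ μ ℙ B +ᴿ 0ᴿ       ≈⟨ +ᴿ-identityʳ (μ ℙ A +ᴿ μ ℙ B) ⟩
      μ ℙ A +ᴿ μ ℙ B             ∎
      where
      Σₙ = partialSum (λ k → μ ℙ (pad A B k)) (2 ℕ.+ n)
      hyp : Σₙ ≈ᴿ μ ℙ A +ᴿ μ ℙ B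
      hyp = subst (λ k → partialSum (λ k → μ ℙ (pad A B k)) k ≈ᴿ μ ℙ A +ᴿ μ ℙ B)
              (ℕ.+-comm n 2) (partialSum-pad A B n)

    μ-∪ : ∀ A B → A ⊥ B → μ ℙ (A ∪ B) ≈ᴿ μ ℙ A +ᴿ μ ℙ B
    μ-∪ A B A⊥B = begin-equality
      μ ℙ (A ∪ B)               ≈⟨ μ-cong ℙ (⋃-pad A B) ⟨
      μ ℙ (⋃ ℕ (pad A B))       ≈⟨ eventually-constant⇒limit
                                     (partialSum λ k → μ ℙ (pad A B k))
                                     (μ ℙ (⋃ ℕ (pad A B))) (μ ℙ A +ᴿ μ ℙ B)
                                     (μ-additive ℙ (pad A B) (pad-disjoint A⊥B))
                                     2 (partialSum-pad A B) ⟩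
      μ ℙ A +ᴿ μ ℙ B            ∎

  module _ (em : ExcludedMiddle ℓ) (ℙ : ProbabilityMeasure W) where

    open ≤ᴿ-Reasoning

    -- B is the disjoint union of A and the rest of B, whose measure is nonnegative; excluded middle
    -- supplies the splitting.
    μ-mono : ∀ A B → A ⊆ B → μ ℙ A ≤ᴿ μ ℙ B
    μ-mono A B A⊆B = begin
      μ ℙ A                       ≈⟨ +ᴿ-identityʳ (μ ℙ A) ⟨
      μ ℙ A +ᴿ 0ᴿ                 ≤⟨ +ᴿ-monoʳ-≤ᴿ (μ ℙ A) 0ᴿ (μ ℙ (B ∩ ∁ A)) (μ-nonneg ℙ (B ∩ ∁ A)) ⟩
      μ ℙ A +ᴿ μ ℙ (B ∩ ∁ A)      ≈⟨ μ-∪ ℙ A (B ∩ ∁ A) (λ (a , _ , ¬a) → contradiction a ¬a) ⟨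
      μ ℙ (A ∪ (B ∩ ∁ A))         ≈⟨ μ-cong ℙ ([ A⊆B , proj₁ ]′ , split) ⟩
      μ ℙ B                       ∎
      where
      split : B ⊆ A ∪ (B ∩ ∁ A)
      split {w} b with em {A w}
      ... | yes a = inj₁ a
      ... | no ¬a = inj₂ (b , ¬a)

    μ≤1 : ∀ A → μ ℙ A ≤ᴿ 1ᴿ
    μ≤1 A = begin
      μ ℙ A ≤⟨ μ-mono A U _ ⟩
      μ ℙ U ≈⟨ μ-total ℙ ⟩
      1ᴿ    ∎

    -- The 1 stays on the right so that only sums of reals occur; `+ᴿ-cancelʳ-≤ᴿ` removes it where a
    -- bound on μ B alone is wanted.
    μ-modus-ponens : ∀ A B C → A ∩ C ⊆ B → μ ℙ A +ᴿ μ ℙ C ≤ᴿ μ ℙ B +ᴿ 1ᴿ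
    μ-modus-ponens A B C A∩C⊆B = begin
      μ ℙ A +ᴿ μ ℙ C              ≤⟨ +ᴿ-monoˡ-≤ᴿ (μ ℙ C) (μ ℙ A) (μ ℙ B +ᴿ μ ℙ A∖B) μA≤μB+ ⟩
      μ ℙ B +ᴿ μ ℙ A∖B +ᴿ μ ℙ C   ≈⟨ +ᴿ-assoc (μ ℙ B) (μ ℙ A∖B) (μ ℙ C) ⟩
      μ ℙ B +ᴿ (μ ℙ A∖B +ᴿ μ ℙ C) ≤⟨ +ᴿ-monoʳ-≤ᴿ (μ ℙ B) (μ ℙ A∖B +ᴿ μ ℙ C) 1ᴿ +μC≤1 ⟩
      μ ℙ B +ᴿ 1ᴿ                 ∎
      where
      A∖B : Pred W ℓ
      A∖B = A ∩ ∁ B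

      split : A ⊆ B ∪ A∖B
      split {w} a with em {B w}
      ... | yes b = inj₁ b
      ... | no ¬b = inj₂ (a , ¬b)

      μA≤μB+ : μ ℙ A ≤ᴿ μ ℙ B +ᴿ μ ℙ A∖B
      μA≤μB+ = begin
        μ ℙ A              ≤⟨ μ-mono A (B ∪ A∖B) split ⟩
        μ ℙ (B ∪ A∖B)      ≈⟨ μ-∪ ℙ B A∖B (λ (b , _ , ¬b) → contradiction b ¬b) ⟩
        μ ℙ B +ᴿ μ ℙ A∖B   ∎

      +μC≤1 : μ ℙ A∖B +ᴿ μ ℙ C ≤ᴿ 1ᴿ
      +μC≤1 = begin
        μ ℙ A∖B +ᴿ μ ℙ C   ≈⟨ μ-∪ ℙ A∖B C (λ ((a , ¬b) , c) → contradiction (A∩C⊆B (a , c)) ¬b) ⟨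
        μ ℙ (A∖B ∪ C)      ≤⟨ μ≤1 (A∖B ∪ C) ⟩
        1ᴿ                 ∎

    μ-modus-ponens-ℚ : ∀ A B C p q → A ∩ C ⊆ B → fromℚ p ≤ᴿ μ ℙ A → fromℚ q ≤ᴿ μ ℙ C →
                       fromℚ (p + q) ≤ᴿ μ ℙ B +ᴿ 1ᴿ
    μ-modus-ponens-ℚ A B C p q A∩C⊆B p≤μA q≤μC = begin
      fromℚ (p + q)          ≈⟨ pointwise⇒≈ᴿ (fromℚ (p + q)) (fromℚ p +ᴿ fromℚ q) (λ _ → refl) ⟩
      fromℚ p +ᴿ fromℚ q     ≤⟨ +ᴿ-mono-≤ᴿ (fromℚ p) (μ ℙ A) (fromℚ q) (μ ℙ C) p≤μA q≤μC ⟩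
      μ ℙ A +ᴿ μ ℙ C         ≤⟨ μ-modus-ponens A B C A∩C⊆B ⟩
      μ ℙ B +ᴿ 1ᴿ            ∎

    μ-certain : ∀ A B C p → A ∩ C ⊆ B → 1ᴿ ≤ᴿ μ ℙ C → fromℚ p ≤ᴿ μ ℙ A → fromℚ p ≤ᴿ μ ℙ B
    μ-certain A B C p A∩C⊆B 1≤μC p≤μA = +ᴿ-cancelʳ-≤ᴿ 1ᴿ (fromℚ p) (μ ℙ B)
      (μ-modus-ponens-ℚ A B C p 1ℚ A∩C⊆B p≤μA 1≤μC)

    μ-contrary : ∀ A C p q → A ⊥ C → fromℚ p ≤ᴿ μ ℙ A → fromℚ q ≤ᴿ μ ℙ C → p + q ≤ 1ℚ
    μ-contrary A C p q A⊥C p≤μA q≤μC = fromℚ-cancel-≤ᴿ (begin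
      fromℚ (p + q)  ≤⟨ μ-modus-ponens-ℚ A ∅ C p q (λ x → contradiction x A⊥C) p≤μA q≤μC ⟩
      μ ℙ ∅ +ᴿ 1ᴿ    ≤⟨ +ᴿ-monoˡ-≤ᴿ 1ᴿ (μ ℙ ∅) 0ᴿ (proj₁ (μ-empty ℙ)) ⟩
      0ᴿ +ᴿ 1ᴿ       ≈⟨ +ᴿ-identityˡ 1ᴿ ⟩
      1ᴿ             ∎)

    μ-⊙ : ∀ A B C α β → A ∩ C ⊆ B → fromℚ ⌊ α ⌋ᴷ ≤ᴿ μ ℙ A → fromℚ ⌊ β ⌋ᴷ ≤ᴿ μ ℙ C →
          fromℚ ⌊ α ⊙ β ⌋ᴷ ≤ᴿ μ ℙ B
    μ-⊙ A B C (mkΘᴷ α _ _) (mkΘᴷ β _ _) A∩C⊆B α≤μA β≤μC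
      with ℚ.⊔-sel 0ℚ (α + β - 1ℚ)
    -- The maximum in `⊙` is one of its two arguments: 0 is a bound by nonnegativity, α + β - 1 by
    -- the main inequality.
    ... | inj₁ eq rewrite eq = μ-nonneg ℙ B
    ... | inj₂ eq rewrite eq = +ᴿ-cancelʳ-≤ᴿ 1ᴿ (fromℚ (α + β - 1ℚ)) (μ ℙ B) (begin
      fromℚ (α + β - 1ℚ) +ᴿ 1ᴿ  ≈⟨ pointwise⇒≈ᴿ (fromℚ (α + β - 1ℚ) +ᴿ 1ᴿ) (fromℚ (α + β))
                                     (λ _ → solve 2 (λ a b → a :+ b :- con 1ℚ :+ con 1ℚ := a :+ b) refl α β) ⟩
      fromℚ (α + β)             ≤⟨ μ-modus-ponens-ℚ A B C α β A∩C⊆B α≤μA β≤μC ⟩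
      μ ℙ B +ᴿ 1ᴿ               ∎)
      where open +-*-Solver

-- Soundness

-- The conclusion is what satisfaction of the abbreviation `∧` unfolds to.
∧-intro : ∀ {a b} {A : Set a} {B : Set b} → A → B → ¬ (A → ¬ B)
∧-intro a b f = f a b

module _ {ℓ} (em : ExcludedMiddle ℓ) {S : Signature} (M : Model ℓ S) where
  open Model M

  valuation : W → Formula S → Bool
  valuation w φ = does (em {⟦_⟧ M φ w})

  -- The letters of `eval` are decided by excluded middle, and `~` and `⇒` preserve reflection.
  eval-reflects : ∀ w φ → Reflects (⟦_⟧ M φ w) (eval (valuation w) φ)
  eval-reflects w (var p)    = proof em
  eval-reflects w (t == s)   = proof em
  eval-reflects w (~ φ)      = ¬-reflects (eval-reflects w φ)
  eval-reflects w (φ ⇒ ψ)    = eval-reflects w φ →-reflects eval-reflects w ψ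
  eval-reflects w (K i θ φ)  = proof em
  eval-reflects w (Kv i η t) = proof em

  -- Existence travels from t to s, but uniqueness needs the converse: a rival value for s is pulled
  -- back to one for t.
  Kv-transfer : ∀ i η t s w →
    (∀ d → fromℚ ⌊ η ⌋ⱽ ≤ᴿ μ (P i w) (⟦_≔_⟧ M t d) → fromℚ ⌊ η ⌋ⱽ ≤ᴿ μ (P i w) (⟦_≔_⟧ M s d)) →
    (∀ d → fromℚ ⌊ η ⌋ⱽ ≤ᴿ μ (P i w) (⟦_≔_⟧ M s d) → fromℚ ⌊ η ⌋ⱽ ≤ᴿ μ (P i w) (⟦_≔_⟧ M t d)) →
    M , w ⊨ Kv i η t → M , w ⊨ Kv i η s
  Kv-transfer i η t s w t→s s→t (d , η≤ , unique) = d , t→s d η≤ , λ {e} → unique ∘ s→t e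

  sound : ∀ {φ} → ⊢ φ → ∀ w → M , w ⊨ φ
  sound (mp ⊢φ ⊢φ⇒ψ) w = sound ⊢φ⇒ψ w (sound ⊢φ w)
  sound (nec {φ} i θ ⊢φ) w = lift (begin
    fromℚ ⌊ θ ⌋ᴷ          ≤⟨ fromℚ-mono-≤ᴿ (Θᴷ.≤1 θ) ⟩
    1ᴿ                    ≈⟨ μ-total (P i w) ⟨
    -- The induction hypothesis is used at every world u, so the extension of φ contains all of W.
    μ (P i w) U           ≤⟨ μ-mono em (P i w) U (⟦_⟧ M φ) (λ {u} _ → sound ⊢φ u) ⟩
    μ (P i w) (⟦_⟧ M φ)   ∎)
    where open ≤ᴿ-Reasoning
  sound (taut {φ} φ-taut) w =
    invert (subst (Reflects (⟦_⟧ M φ w)) (φ-taut (valuation w)) (eval-reflects w φ))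
  sound (==-refl t) w = refl
  sound (==-sym t s) w = sym
  -- The conjunction in the premise is encoded by negation and yields the equality only doubly
  -- negated; excluded middle removes the double negation.
  sound (==-trans t s u) w t=s∧s=u =
    decidable-stable em λ t≠u → t=s∧s=u λ t=s s=u → t≠u (trans t=s s=u)
  sound (==-subst t s u) w t=s = ∧-intro (trans (sym t=s)) (trans t=s)
  sound (K-mono i θ θ′ φ θ≤θ′) w (lift θ′≤μ) = lift
    (≤ᴿ-trans (fromℚ ⌊ θ ⌋ᴷ) (fromℚ ⌊ θ′ ⌋ᴷ) (μ (P i w) (⟦_⟧ M φ)) (fromℚ-mono-≤ᴿ θ≤θ′) θ′≤μ)
  sound (K-dist i α β φ ψ) w (lift α≤μ) (lift β≤μ) = lift
    (μ-⊙ em (P i w) (⟦_⟧ M (φ ⇒ ψ)) (⟦_⟧ M ψ) (⟦_⟧ M φ) α β (λ (f , x) → f x) α≤μ β≤μ)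
  sound (K-cons i α β φ 1<α+β) w (lift α≤μ) (lift β≤μ) = ℚ.<-irrefl refl (ℚ.<-≤-trans 1<α+β
    (μ-contrary em (P i w) (⟦_⟧ M φ) (⟦_⟧ M (~ φ)) ⌊ α ⌋ᴷ ⌊ β ⌋ᴷ
      (λ (x , ¬x) → contradiction x ¬x) α≤μ β≤μ))
  sound (K-zero i φ) w = lift (μ-nonneg (P i w) (⟦_⟧ M φ))
  sound (K-== i θ t s u) w (lift 1≤μ) = ∧-intro
    (λ (lift θ≤μ) → lift (μ-certain em (P i w) (⟦_⟧ M (t == u)) (⟦_⟧ M (s == u)) (⟦_⟧ M (t == s))
      ⌊ θ ⌋ᴷ (λ (t=u , t=s) → trans (sym t=s) t=u) 1≤μ θ≤μ))
    (λ (lift θ≤μ) → lift (μ-certain em (P i w) (⟦_⟧ M (s == u)) (⟦_⟧ M (t == u)) (⟦_⟧ M (t == s))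
      ⌊ θ ⌋ᴷ (λ (s=u , t=s) → trans t=s s=u) 1≤μ θ≤μ))
  sound (Kv-== i η t s) w (lift 1≤μ) =
    ∧-intro (Kv-transfer i η t s w t→s s→t) (Kv-transfer i η s t w s→t t→s)
    where
    t→s : ∀ d → fromℚ ⌊ η ⌋ⱽ ≤ᴿ μ (P i w) (⟦_≔_⟧ M t d) → fromℚ ⌊ η ⌋ⱽ ≤ᴿ μ (P i w) (⟦_≔_⟧ M s d)
    t→s d = μ-certain em (P i w) (⟦_≔_⟧ M t d) (⟦_≔_⟧ M s d) (⟦_⟧ M (t == s))
      ⌊ η ⌋ⱽ (λ (t=d , t=s) → trans (sym t=s) t=d) 1≤μ
    s→t : ∀ d → fromℚ ⌊ η ⌋ⱽ ≤ᴿ μ (P i w) (⟦_≔_⟧ M s d) → fromℚ ⌊ η ⌋ⱽ ≤ᴿ μ (P i w) (⟦_≔_⟧ M t d)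
    s→t d = μ-certain em (P i w) (⟦_≔_⟧ M s d) (⟦_≔_⟧ M t d) (⟦_⟧ M (t == s))
      ⌊ η ⌋ⱽ (λ (s=d , t=s) → trans t=s s=d) 1≤μ

theorem1 : (ℓ : Level) → ExcludedMiddle ℓ →
    (S : Signature) (φ : Formula S) → ⊢ φ → Valid ℓ φ
theorem1 ℓ em S φ ⊢φ M = sound em M ⊢φ
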